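{- For every real number $c > 0$, the set $$M_c = \{y\in\mathbb{N} : \exists k\in\mathbb{N} \text{ such that } T^k(y) < cy\}$$ has density $1$.
   Context: $\mathbb{N}=\{0,1,2,\dots\}$. The Collatz map $T\colon\mathbb{N}\to\mathbb{N}$ is defined by $T(n)=n/2$ if $n$ is even and $T(n)=(3n+1)/2$ if $n$ is odd; $T^k$ denotes the $k$-th iterate of $T$ ($T^0$ is the identity). For $A\subset\mathbb{N}$, the upper density is $\overline{d}(A)=\limsup_{n\to\infty}|A\cap[0,n]|/n$ and the lower density is $\underline{d}(A)=\liminf_{n\to\infty}|A\cap[0,n]|/n$; if they are equal, $A$ has density $d(A)=\overline{d}(A)=\underline{d}(A)$. -}

module Defs where

open import Algebra.Bundles using (CommutativeMonoid)
import Algebra.Properties.CommutativeSemigroup as CommutativeSemigroup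
open import Data.Nat.Base as ℕ using (ℕ; zero; suc; NonZero; _%_)
import Data.Nat.DivMod as ℕ
import Data.Nat.Properties as ℕ
open import Data.Integer.Base using (+_)
import Data.Integer as ℤ
import Data.Integer.Properties as ℤ
open import Data.Rational.Base as ℚ using (ℚ; 0ℚ; 1ℚ; ½; ∣_∣; 1/_; positive)
import Data.Rational.Properties as ℚ
open import Algebra.Properties.Group ℚ.+-0-group using (//-rightDividesˡ)
open import Algebra.Properties.Ring ℚ.+-*-ring using (x[y-z]≈xy-xz)
open import Data.Rational.Unnormalised.Base using (mkℚᵘ; *≤*)
import Data.Rational.Unnormalised.Properties as ℚᵘ
open import Data.Fin.Base using (toℕ)
open import Data.Fin.Subset as Subset using (Subset) renaming (_∈_ to _∈ₛ_)
open import Data.Fin.Subset.Properties using (p⊆q⇒∣p∣≤∣q∣)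
open import Data.Product.Base using (∃-syntax; Σ-syntax; _×_; _,_)
open import Function.Bundles using (_⇔_; mk⇔; Equivalence)
open import Function.Endo.Propositional ℕ using (_^_)
open import Level using (0ℓ)
open import Relation.Binary.PropositionalEquality
  using (_≡_; sym; trans; cong; cong₂; subst; module ≡-Reasoning)
open import Relation.Unary using (Pred; _∈_)

-- Reals as Cauchy sequences of rationals with explicit modulus.  Equality of
-- reals is never needed: only the strict order and the operations occur.

IsCauchy : (ℕ → ℚ) → Set
IsCauchy s = ∀ ε → 0ℚ ℚ.< ε →
  ∃[ N ] (∀ m n → N ℕ.≤ m → N ℕ.≤ n → ∣ s m ℚ.- s n ∣ ℚ.< ε)

record ℝ : Set where
  constructor mkℝ
  field
    seq    : ℕ → ℚ
    cauchy : IsCauchy seq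

open ℝ public

private
  module +ᴾ = CommutativeSemigroup
    (CommutativeMonoid.commutativeSemigroup ℚ.+-0-commutativeMonoid)
  module *ᴾ = CommutativeSemigroup
    (CommutativeMonoid.commutativeSemigroup ℚ.*-1-commutativeMonoid)

  minus-plus : ∀ a b → a ≡ (a ℚ.- b) ℚ.+ b
  minus-plus a b = sym (//-rightDividesˡ b a)

  sum-diff : ∀ a b c d → (a ℚ.+ b) ℚ.- (c ℚ.+ d) ≡ (a ℚ.- c) ℚ.+ (b ℚ.- d)
  sum-diff a b c d = trans (cong (a ℚ.+ b ℚ.+_) (ℚ.neg-distrib-+ c d))
    (+ᴾ.interchange a b (ℚ.- c) (ℚ.- d))

  product-diff : ∀ a b c d →
    a ℚ.* b ℚ.- c ℚ.* d ≡ a ℚ.* (b ℚ.- d) ℚ.+ d ℚ.* (a ℚ.- c)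
  product-diff a b c d = begin
    a ℚ.* b ℚ.- c ℚ.* d
      ≡⟨ cong₂ (λ x y → x ℚ.- y) (minus-plus (a ℚ.* b) (a ℚ.* d)) (ℚ.*-comm c d) ⟩
    (a ℚ.* b ℚ.- a ℚ.* d) ℚ.+ a ℚ.* d ℚ.- d ℚ.* c
      ≡⟨ ℚ.+-assoc (a ℚ.* b ℚ.- a ℚ.* d) (a ℚ.* d) (ℚ.- (d ℚ.* c)) ⟩
    (a ℚ.* b ℚ.- a ℚ.* d) ℚ.+ (a ℚ.* d ℚ.- d ℚ.* c)
      ≡⟨ cong (λ x → (a ℚ.* b ℚ.- a ℚ.* d) ℚ.+ (x ℚ.- d ℚ.* c)) (ℚ.*-comm a d) ⟩
    (a ℚ.* b ℚ.- a ℚ.* d) ℚ.+ (d ℚ.* a ℚ.- d ℚ.* c)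
      ≡⟨ cong₂ ℚ._+_ (x[y-z]≈xy-xz a b d) (x[y-z]≈xy-xz d a c) ⟨
    a ℚ.* (b ℚ.- d) ℚ.+ d ℚ.* (a ℚ.- c) ∎
    where open ≡-Reasoning

  half-sum : ∀ ε → ε ℚ.* ½ ℚ.+ ε ℚ.* ½ ≡ ε
  half-sum ε = trans (sym (ℚ.*-distribˡ-+ ε ½ ½)) (ℚ.*-identityʳ ε)

  half-pos : ∀ {ε} → 0ℚ ℚ.< ε → 0ℚ ℚ.< ε ℚ.* ½
  half-pos {ε} 0<ε =
    ℚ.positive⁻¹ (ε ℚ.* ½) {{ℚ.pos*pos⇒pos ε {{positive 0<ε}} ½}}

  /-mono-≤ : ∀ {a b} n .{{_ : NonZero n}} → a ℕ.≤ b → (+ a ℚ./ n) ℚ.≤ (+ b ℚ./ n)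
  /-mono-≤ {a} {b} (suc k) a≤b = ℚ.toℚᵘ-cancel-≤ (begin
    ℚ.toℚᵘ (+ a ℚ./ suc k) ≃⟨ ℚ.toℚᵘ-fromℚᵘ (mkℚᵘ (+ a) k) ⟩
    mkℚᵘ (+ a) k           ≤⟨ *≤* (ℤ.*-monoʳ-≤-nonNeg (+ suc k) (ℤ.+≤+ a≤b)) ⟩
    mkℚᵘ (+ b) k           ≃⟨ ℚᵘ.≃-sym (ℚ.toℚᵘ-fromℚᵘ (mkℚᵘ (+ b) k)) ⟩
    ℚ.toℚᵘ (+ b ℚ./ suc k) ∎)
    where open ℚᵘ.≤-Reasoning

  eventually-bounded : ∀ {s} → IsCauchy s →
    ∃[ K ] ∃[ N ] (0ℚ ℚ.< K × ∀ n → N ℕ.≤ n → ∣ s n ∣ ℚ.≤ K)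
  eventually-bounded {s} cs with cs 1ℚ (ℚ.positive⁻¹ 1ℚ)
  ... | N , near = 1ℚ ℚ.+ ∣ s N ∣ , N , 0<K , bound
    where
    0<K : 0ℚ ℚ.< 1ℚ ℚ.+ ∣ s N ∣
    0<K = ℚ.+-mono-<-≤ (ℚ.positive⁻¹ 1ℚ) (ℚ.0≤∣p∣ (s N))

    bound : ∀ n → N ℕ.≤ n → ∣ s n ∣ ℚ.≤ 1ℚ ℚ.+ ∣ s N ∣
    bound n N≤n = begin
      ∣ s n ∣
        ≡⟨ cong ∣_∣ (minus-plus (s n) (s N)) ⟩
      ∣ (s n ℚ.- s N) ℚ.+ s N ∣
        ≤⟨ ℚ.∣p+q∣≤∣p∣+∣q∣ (s n ℚ.- s N) (s N) ⟩
      ∣ s n ℚ.- s N ∣ ℚ.+ ∣ s N ∣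
        ≤⟨ ℚ.+-monoˡ-≤ ∣ s N ∣ (ℚ.<⇒≤ (near n N N≤n ℕ.≤-refl)) ⟩
      1ℚ ℚ.+ ∣ s N ∣ ∎
      where open ℚ.≤-Reasoning

  +-cauchy : ∀ {s t} → IsCauchy s → IsCauchy t → IsCauchy (λ n → s n ℚ.+ t n)
  +-cauchy {s} {t} cs ct ε 0<ε
    with cs (ε ℚ.* ½) (half-pos 0<ε) | ct (ε ℚ.* ½) (half-pos 0<ε)
  ... | M , nearₛ | N , nearₜ = M ℕ.+ N , near
    where
    near : ∀ m n → M ℕ.+ N ℕ.≤ m → M ℕ.+ N ℕ.≤ n →
           ∣ (s m ℚ.+ t m) ℚ.- (s n ℚ.+ t n) ∣ ℚ.< ε
    near m n ≤m ≤n = begin-strict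
      ∣ (s m ℚ.+ t m) ℚ.- (s n ℚ.+ t n) ∣
        ≡⟨ cong ∣_∣ (sum-diff (s m) (t m) (s n) (t n)) ⟩
      ∣ (s m ℚ.- s n) ℚ.+ (t m ℚ.- t n) ∣
        ≤⟨ ℚ.∣p+q∣≤∣p∣+∣q∣ (s m ℚ.- s n) (t m ℚ.- t n) ⟩
      ∣ s m ℚ.- s n ∣ ℚ.+ ∣ t m ℚ.- t n ∣
        <⟨ ℚ.+-mono-< (nearₛ m n (ℕ.m+n≤o⇒m≤o M ≤m) (ℕ.m+n≤o⇒m≤o M ≤n))
                      (nearₜ m n (ℕ.m+n≤o⇒n≤o M ≤m) (ℕ.m+n≤o⇒n≤o M ≤n)) ⟩
      ε ℚ.* ½ ℚ.+ ε ℚ.* ½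
        ≡⟨ half-sum ε ⟩
      ε ∎
      where open ℚ.≤-Reasoning

  neg-cauchy : ∀ {s} → IsCauchy s → IsCauchy (λ n → ℚ.- s n)
  neg-cauchy {s} cs ε 0<ε with cs ε 0<ε
  ... | N , near = N , λ m n ≤m ≤n →
    subst (ℚ._< ε) (sym (flip-sign (s m) (s n))) (near m n ≤m ≤n)
    where
    flip-sign : ∀ a b → ∣ ℚ.- a ℚ.- ℚ.- b ∣ ≡ ∣ a ℚ.- b ∣
    flip-sign a b = trans
      (cong ∣_∣ (sym (ℚ.neg-distrib-+ a (ℚ.- b))))
      (ℚ.∣-p∣≡∣p∣ (a ℚ.- b))

  -- If ∣ u ∣ ≤ K and ∣ v ∣ is small enough, then ∣ u v ∣ < ε.
  scaled : ∀ {K} (0<K : 0ℚ ℚ.< K) (ε : ℚ) →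
           let instance K≢0 = ℚ.pos⇒nonZero K {{positive 0<K}} in
           ∀ u v → ∣ u ∣ ℚ.≤ K → ∣ v ∣ ℚ.< ε ℚ.* 1/ K → ∣ u ℚ.* v ∣ ℚ.< ε
  scaled {K} 0<K ε u v u≤K v<ε/K = begin-strict
      ∣ u ℚ.* v ∣          ≡⟨ ℚ.∣p*q∣≡∣p∣*∣q∣ u v ⟩
      ∣ u ∣ ℚ.* ∣ v ∣      ≤⟨ ℚ.*-monoʳ-≤-nonNeg ∣ v ∣ {{ℚ.∣-∣-nonNeg v}} u≤K ⟩
      K ℚ.* ∣ v ∣          <⟨ ℚ.*-monoʳ-<-pos K {{positive 0<K}} v<ε/K ⟩
      K ℚ.* (ε ℚ.* 1/ K)   ≡⟨ *ᴾ.x∙yz≈y∙xz K ε (1/ K) ⟩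
      ε ℚ.* (K ℚ.* 1/ K)   ≡⟨ cong (ε ℚ.*_) (ℚ.*-inverseʳ K) ⟩
      ε ℚ.* 1ℚ             ≡⟨ ℚ.*-identityʳ ε ⟩
      ε ∎
    where
    open ℚ.≤-Reasoning
    instance K≢0 = ℚ.pos⇒nonZero K {{positive 0<K}}

  scaled-pos : ∀ {K} (0<K : 0ℚ ℚ.< K) {ε} → 0ℚ ℚ.< ε →
           let instance K≢0 = ℚ.pos⇒nonZero K {{positive 0<K}} in 0ℚ ℚ.< ε ℚ.* 1/ K
  scaled-pos {K} 0<K {ε} 0<ε = ℚ.positive⁻¹ (ε ℚ.* 1/ K)
    {{ℚ.pos*pos⇒pos ε {{positive 0<ε}} (1/ K) {{ℚ.1/pos⇒pos K {{positive 0<K}}}}}}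
    where instance K≢0 = ℚ.pos⇒nonZero K {{positive 0<K}}

  *-cauchy : ∀ {s t} → IsCauchy s → IsCauchy t → IsCauchy (λ n → s n ℚ.* t n)
  *-cauchy {s} {t} cs ct ε 0<ε =
    let open ℚ.≤-Reasoning
        K , P , 0<K , s≤K = eventually-bounded cs
        L , Q , 0<L , t≤L = eventually-bounded ct
        M , nearₛ = cs _ (scaled-pos 0<L (half-pos 0<ε))
        N , nearₜ = ct _ (scaled-pos 0<K (half-pos 0<ε))
    in (P ℕ.+ Q) ℕ.+ (M ℕ.+ N) , λ m n ≤m ≤n → begin-strict
      ∣ s m ℚ.* t m ℚ.- s n ℚ.* t n ∣
        ≡⟨ cong ∣_∣ (product-diff (s m) (t m) (s n) (t n)) ⟩
      ∣ s m ℚ.* (t m ℚ.- t n) ℚ.+ t n ℚ.* (s m ℚ.- s n) ∣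
        ≤⟨ ℚ.∣p+q∣≤∣p∣+∣q∣ (s m ℚ.* (t m ℚ.- t n)) (t n ℚ.* (s m ℚ.- s n)) ⟩
      ∣ s m ℚ.* (t m ℚ.- t n) ∣ ℚ.+ ∣ t n ℚ.* (s m ℚ.- s n) ∣
        <⟨ ℚ.+-mono-<
             (scaled 0<K (ε ℚ.* ½) (s m) (t m ℚ.- t n)
               (s≤K m (ℕ.m+n≤o⇒m≤o P (ℕ.m+n≤o⇒m≤o (P ℕ.+ Q) ≤m)))
               (nearₜ m n (ℕ.m+n≤o⇒n≤o M (ℕ.m+n≤o⇒n≤o (P ℕ.+ Q) ≤m))
                          (ℕ.m+n≤o⇒n≤o M (ℕ.m+n≤o⇒n≤o (P ℕ.+ Q) ≤n))))
             (scaled 0<L (ε ℚ.* ½) (t n) (s m ℚ.- s n)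
               (t≤L n (ℕ.m+n≤o⇒n≤o P (ℕ.m+n≤o⇒m≤o (P ℕ.+ Q) ≤n)))
               (nearₛ m n (ℕ.m+n≤o⇒m≤o M (ℕ.m+n≤o⇒n≤o (P ℕ.+ Q) ≤m))
                          (ℕ.m+n≤o⇒m≤o M (ℕ.m+n≤o⇒n≤o (P ℕ.+ Q) ≤n)))) ⟩
      ε ℚ.* ½ ℚ.+ ε ℚ.* ½
        ≡⟨ half-sum ε ⟩
      ε ∎

infixl 7 _*_
infixl 6 _+_ _-_
infix  8 -_
infix  4 _<_

fromℚ : ℚ → ℝ
fromℚ q = mkℝ (λ _ → q) λ ε 0<ε →
  0 , λ _ _ _ _ → subst (λ p → ∣ p ∣ ℚ.< ε) (sym (ℚ.+-inverseʳ q)) 0<ε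

fromℕ : ℕ → ℝ
fromℕ n = fromℚ (+ n ℚ./ 1)

0ℝ 1ℝ : ℝ
0ℝ = fromℕ 0
1ℝ = fromℕ 1

-_ : ℝ → ℝ
- mkℝ s cs = mkℝ (λ n → ℚ.- s n) (neg-cauchy {s} cs)

_+_ _-_ _*_ : ℝ → ℝ → ℝ
mkℝ s cs + mkℝ t ct = mkℝ (λ n → s n ℚ.+ t n) (+-cauchy {s} {t} cs ct)
mkℝ s cs * mkℝ t ct = mkℝ (λ n → s n ℚ.* t n) (*-cauchy {s} {t} cs ct)
x - y = x + (- y)

_<_ : ℝ → ℝ → Set
x < y = ∃[ δ ] (0ℚ ℚ.< δ × ∃[ N ] (∀ n → N ℕ.≤ n → seq x n ℚ.+ δ ℚ.≤ seq y n))

-- The value at index n of a sequence defined for n ≥ 1 only.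
PositiveIndexed : Set₁
PositiveIndexed = ∀ n → .{{NonZero n}} → Set

Eventually Frequently : PositiveIndexed → Set
Eventually P = ∃[ N ] (∀ n → .{{_ : NonZero n}} → N ℕ.≤ n → P n)
Frequently P = ∀ N → ∃[ n ] Σ[ n≢0 ∈ NonZero n ] (N ℕ.≤ n × P n {{n≢0}})

-- A finite F ⊆ {0,…,n} is a `Subset (suc n)`.  Since A need not be decidable,
-- constructively A ∩ [0,n] need not be of this form, so ∣A ∩ [0,n]∣ is used
-- through its comparisons: it is the largest size of an F ⊆ A ∩ [0,n].  Hence
-- ∣A ∩ [0,n]∣/n < x means ∣F∣/n < x for all such F, and x < ∣A ∩ [0,n]∣/n means
-- x < ∣F∣/n for some such F.  When A ∩ [0,n] is itself a `Subset (suc n)`, these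
-- are the usual comparisons: see `ratio<⇔` and `<ratio⇔`.

_⊆_ : ∀ {m} → Subset m → Pred ℕ 0ℓ → Set
F ⊆ A = ∀ i → i ∈ₛ F → toℕ i ∈ A

∣_∣/_ : ∀ {m} → Subset m → (n : ℕ) → .{{NonZero n}} → ℝ
∣ F ∣/ n = fromℚ (+ Subset.∣ F ∣ ℚ./ n)

Ratio< <Ratio : Pred ℕ 0ℓ → ℝ → PositiveIndexed
Ratio< A x n = ∀ (F : Subset (suc n)) → F ⊆ A → ∣ F ∣/ n < x
<Ratio A x n = ∃[ F ] (_⊆_ {suc n} F A × x < ∣ F ∣/ n)

-- limsup a = d iff for all ε > 0, eventually a n < d + ε and infinitely often
-- d - ε < a n; dually for liminf.

HasUpperDensity HasLowerDensity HasDensity : Pred ℕ 0ℓ → ℝ → Set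
HasUpperDensity A d = ∀ ε → 0ℝ < ε →
  Eventually (Ratio< A (d + ε)) × Frequently (<Ratio A (d - ε))
HasLowerDensity A d = ∀ ε → 0ℝ < ε →
  Eventually (<Ratio A (d - ε)) × Frequently (Ratio< A (d + ε))
HasDensity A d = HasUpperDensity A d × HasLowerDensity A d

module _ {A : Pred ℕ 0ℓ} {n : ℕ} .{{_ : NonZero n}} {x : ℝ}
         (F : Subset (suc n)) (F≐A : ∀ i → i ∈ₛ F ⇔ toℕ i ∈ A) where

  private
    F⊆A : F ⊆ A
    F⊆A i = Equivalence.to (F≐A i)

    largest : ∀ G → G ⊆ A → (+ Subset.∣ G ∣ ℚ./ n) ℚ.≤ (+ Subset.∣ F ∣ ℚ./ n)
    largest G G⊆A = /-mono-≤ n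
      (p⊆q⇒∣p∣≤∣q∣ (λ {i} i∈G → Equivalence.from (F≐A i) (G⊆A i i∈G)))

  ratio<⇔ : Ratio< A x n ⇔ (∣ F ∣/ n < x)
  ratio<⇔ = mk⇔ (λ below → below F F⊆A)
    λ (δ , 0<δ , N , gap) G G⊆A → δ , 0<δ , N , λ m N≤m →
      ℚ.≤-trans (ℚ.+-monoˡ-≤ δ (largest G G⊆A)) (gap m N≤m)

  <ratio⇔ : <Ratio A x n ⇔ (x < ∣ F ∣/ n)
  <ratio⇔ = mk⇔
    (λ (G , G⊆A , δ , 0<δ , N , gap) → δ , 0<δ , N , λ m N≤m →
      ℚ.≤-trans (gap m N≤m) (largest G G⊆A))
    λ above → F , F⊆A , above

T : ℕ → ℕ
T n with n % 2
... | zero  = n ℕ./ 2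
... | suc _ = (3 ℕ.* n ℕ.+ 1) ℕ./ 2

M : ℝ → Pred ℕ 0ℓ
M c y = ∃[ k ] (fromℕ ((T ^ k) y) < c * fromℕ y)

{-# OPTIONS --safe #-}
module Submission where

-- Let j be the number of odd terms among y, T y, …, T^(k-1) y.  Then
-- 2^k T^k(y) ≤ 3^j y + 3^k, and over any 2^k consecutive y the sum of 2^j is
-- exactly 3^k.  Take k = 8 m.  By Markov's inequality j > 5 m holds for a
-- proportion of at most (3⁸/2¹³)^m of all y, and for the other y the ratio
-- T^k(y)/y is at most about (3⁵/2⁸)^m.  Both bounds tend to 0 as m grows.

open import Defs using (T; _⊆_)
open import Algebra.Bundles using (CommutativeMonoid)
open import Data.Fin.Base using (toℕ; zero; suc)
open import Data.Fin.Subset as Subset using (inside; outside)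
open import Data.Fin.Subset.Properties using (∣p∣≤n)
open import Data.List.Base using (applyUpTo)
open import Data.Nat.Base as ℕ using (ℕ; zero; suc; NonZero)
open import Data.Nat.DivMod
  using (m*n%n≡0; m*n/n≡m; [m+kn]%n≡m%n; m≡m%n+[m/n]*n; m/n*n≤m; m%n<n)
open import Data.Nat.ListAction using (sum)
import Data.Nat.Properties as ℕ
open import Data.Nat.Tactic.RingSolver using (solve-∀)
open import Data.Product.Base using (∃-syntax; _×_; _,_)
open import Data.Rational.Base as ℚ using (0ℚ; 1ℚ; mkℚ)
import Data.Rational.Properties as ℚ
open import Data.Rational.Unnormalised.Base as ℚᵘ using (mkℚᵘ; *≤*)
import Data.Rational.Unnormalised.Properties as ℚᵘ
open import Data.Sum.Base using (_⊎_; inj₁; inj₂)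
open import Data.Vec.Base using ([]; _∷_; here; there)
open import Function.Endo.Propositional ℕ using () renaming (_^_ to _^ᶠ_)
open import Level using (0ℓ)
open import Relation.Binary.PropositionalEquality
  using (_≡_; refl; sym; trans; cong; cong₂; subst; subst₂; module ≡-Reasoning)
open import Relation.Unary using (Pred)

module Collatz where
  open import Data.Nat.Base using (_+_; _*_; _∸_; _^_; _≤_; _<_; _%_; _/_; z≤n; s≤s)
  open Subset using (∣_∣)

  -- Finite sums and Markov's inequality.

  Σ< : ℕ → (ℕ → ℕ) → ℕ
  Σ< n f = sum (applyUpTo f n)

  Σ<-cong : ∀ n {f g : ℕ → ℕ} → (∀ y → f y ≡ g y) → Σ< n f ≡ Σ< n g
  Σ<-cong zero    f≗g = refl
  Σ<-cong (suc n) f≗g = cong₂ _+_ (f≗g 0) (Σ<-cong n (λ y → f≗g (suc y)))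

  Σ<-distrib-+ : ∀ n (f g : ℕ → ℕ) → Σ< n (λ y → f y + g y) ≡ Σ< n f + Σ< n g
  Σ<-distrib-+ zero    f g = refl
  Σ<-distrib-+ (suc n) f g
    rewrite Σ<-distrib-+ n (λ y → f (suc y)) (λ y → g (suc y)) =
    interchange (f 0) (g 0) (Σ< n (λ y → f (suc y))) (Σ< n (λ y → g (suc y)))
    where
    interchange : ∀ a b c d → a + b + (c + d) ≡ a + c + (b + d)
    interchange = solve-∀

  Σ<-distribˡ-* : ∀ c n (f : ℕ → ℕ) → Σ< n (λ y → c * f y) ≡ c * Σ< n f
  Σ<-distribˡ-* c zero    f = sym (ℕ.*-zeroʳ c)
  Σ<-distribˡ-* c (suc n) f =
    trans (cong ((c * f 0) +_) (Σ<-distribˡ-* c n (λ y → f (suc y))))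
          (sym (ℕ.*-distribˡ-+ c (f 0) (Σ< n (λ y → f (suc y)))))

  Σ<-+ : ∀ m n (f : ℕ → ℕ) → Σ< (m + n) f ≡ Σ< m f + Σ< n (λ y → f (m + y))
  Σ<-+ zero    n f = refl
  Σ<-+ (suc m) n f =
    trans (cong (f 0 +_) (Σ<-+ m n (λ y → f (suc y))))
          (sym (ℕ.+-assoc (f 0) (Σ< m (λ y → f (suc y))) _))

  Σ<-monoˡ-≤ : ∀ {m n} (f : ℕ → ℕ) → m ≤ n → Σ< m f ≤ Σ< n f
  Σ<-monoˡ-≤ f z≤n       = z≤n
  Σ<-monoˡ-≤ f (s≤s m≤n) = ℕ.+-monoʳ-≤ (f 0) (Σ<-monoˡ-≤ (λ y → f (suc y)) m≤n)

  Σ<-even-odd : ∀ n (f : ℕ → ℕ) →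
    Σ< (n * 2) f ≡ Σ< n (λ y → f (y * 2)) + Σ< n (λ y → f (1 + y * 2))
  Σ<-even-odd zero    f = refl
  Σ<-even-odd (suc n) f rewrite Σ<-even-odd n (λ y → f (2 + y)) =
    rearrange (f 0) (f 1) (Σ< n (λ y → f (2 + y * 2))) (Σ< n (λ y → f (3 + y * 2)))
    where
    rearrange : ∀ a b c d → a + (b + (c + d)) ≡ a + c + (b + d)
    rearrange = solve-∀

  -- The hypothesis covers windows at every offset `b`, so it passes to the shifted function in the
  -- induction on `q`.
  Σ<-blocks : ∀ q N {s} (f : ℕ → ℕ) →
    (∀ b → Σ< N (λ y → f (b + y)) ≡ s) → Σ< (q * N) f ≡ q * s
  Σ<-blocks zero    N f block = refl
  Σ<-blocks (suc q) N f block = trans (Σ<-+ N (q * N) f)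
    (cong₂ _+_ (block 0) (Σ<-blocks q N (λ y → f (N + y)) (λ b →
      trans (Σ<-cong N (λ y → cong f (sym (ℕ.+-assoc N b y)))) (block (N + b)))))

  -- At most `Y` terms are nonzero and each is at most `Y`. The point is a bound independent of `n`.
  Σ<-∸ : ∀ n Y → Σ< n (Y ∸_) ≤ Y * Y
  Σ<-∸ zero    Y       = z≤n
  Σ<-∸ (suc n) zero    = ℕ.≤-trans
    (ℕ.≤-reflexive (Σ<-cong n (λ y → sym (ℕ.0∸n≡0 y)))) (Σ<-∸ n zero)
  Σ<-∸ (suc n) (suc Y) = s≤s (ℕ.+-monoʳ-≤ Y
    (ℕ.≤-trans (Σ<-∸ n Y) (ℕ.*-monoʳ-≤ Y (ℕ.n≤1+n Y))))

  -- `F` collects the indices where `dichotomy` answers with membership in `A`; every index left out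
  -- pays its share `W` from its own weight.
  markov : ∀ W n {A : Pred ℕ 0ℓ} (w : ℕ → ℕ) → (∀ y → A y ⊎ W ≤ w y) →
    ∃[ F ] (_⊆_ {n} F A × W * n ≤ W * ∣ F ∣ + Σ< n w)
  markov W zero    w dichotomy = [] , (λ _ ()) , ℕ.m≤m+n (W * 0) 0
  markov W (suc n) {A} w dichotomy
    with markov W n (λ y → w (suc y)) (λ y → dichotomy (suc y)) | dichotomy 0
  ... | F , F⊆A , bound | inj₁ A0 =
    inside ∷ F , (λ { zero here → A0 ; (suc i) (there i∈F) → F⊆A i i∈F }) , (begin
      W * suc n                              ≡⟨ ℕ.*-suc W n ⟩
      W + W * n                              ≤⟨ ℕ.+-monoʳ-≤ W bound ⟩
      W + (W * ∣ F ∣ + S)                    ≡⟨ ℕ.+-assoc W (W * ∣ F ∣) S ⟨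
      W + W * ∣ F ∣ + S                      ≡⟨ cong (_+ S) (ℕ.*-suc W ∣ F ∣) ⟨
      W * suc ∣ F ∣ + S                      ≤⟨ ℕ.+-monoʳ-≤ (W * suc ∣ F ∣) (ℕ.m≤n+m S (w 0)) ⟩
      W * suc ∣ F ∣ + (w 0 + S)              ∎)
    where
    open ℕ.≤-Reasoning
    S = Σ< n (λ y → w (suc y))
  ... | F , F⊆A , bound | inj₂ W≤w0 =
    outside ∷ F , (λ { (suc i) (there i∈F) → F⊆A i i∈F }) , (begin
      W * suc n                              ≡⟨ ℕ.*-suc W n ⟩
      W + W * n                              ≤⟨ ℕ.+-mono-≤ W≤w0 bound ⟩
      w 0 + (W * ∣ F ∣ + S)                  ≡⟨ swap (w 0) (W * ∣ F ∣) S ⟩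
      W * ∣ F ∣ + (w 0 + S)                  ∎)
    where
    open ℕ.≤-Reasoning
    S = Σ< n (λ y → w (suc y))
    swap : ∀ a b c → a + (b + c) ≡ b + (a + c)
    swap = solve-∀

  -- Parity, the odd steps of an orbit, and the size of T^k(y).

  data Parity : ℕ → Set where
    even : ∀ z → Parity (z * 2)
    odd  : ∀ z → Parity (1 + z * 2)

  parity : ∀ n → Parity n
  parity zero          = even 0
  parity (suc n) with parity n
  ... | even z = odd z
  ... | odd z  = even (suc z)

  T-even : ∀ z → T (z * 2) ≡ z
  T-even z rewrite m*n%n≡0 z 2 {{_}} = m*n/n≡m z 2

  T-odd : ∀ z → T (1 + z * 2) ≡ 2 + 3 * z
  T-odd z rewrite [m+kn]%n≡m%n 1 z 2 {{_}} =
    trans (cong (_/ 2) (double z)) (m*n/n≡m (2 + 3 * z) 2)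
    where
    double : ∀ z → 3 * (1 + z * 2) + 1 ≡ (2 + 3 * z) * 2
    double = solve-∀

  T^-suc : ∀ k y → (T ^ᶠ suc k) y ≡ (T ^ᶠ k) (T y)
  T^-suc zero    y = refl
  T^-suc (suc k) y = cong T (T^-suc k y)

  oddSteps : ℕ → ℕ → ℕ
  oddSteps zero    y = 0
  oddSteps (suc k) y = y % 2 + oddSteps k (T y)

  oddSteps-even : ∀ k z → oddSteps (suc k) (z * 2) ≡ oddSteps k z
  oddSteps-even k z = cong₂ _+_ (m*n%n≡0 z 2) (cong (oddSteps k) (T-even z))

  oddSteps-odd : ∀ k z → oddSteps (suc k) (1 + z * 2) ≡ 1 + oddSteps k (2 + 3 * z)
  oddSteps-odd k z = cong₂ _+_ ([m+kn]%n≡m%n 1 z 2) (cong (oddSteps k) (T-odd z))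

  oddSteps≤ : ∀ k y → oddSteps k y ≤ k
  oddSteps≤ zero    y = z≤n
  oddSteps≤ (suc k) y = ℕ.+-mono-≤ (ℕ.s≤s⁻¹ (m%n<n y 2)) (oddSteps≤ k (T y))

  -- The first step is peeled off: 2 T(y) is y or 3y + 1. Only the odd case adds an error, 3^j with
  -- j ≤ k, and the room between 2 * 3^k and 3^(k+1) absorbs it.
  2^k*T^k≤ : ∀ k y → 2 ^ k * (T ^ᶠ k) y ≤ 3 ^ oddSteps k y * y + 3 ^ k
  2^k*T^k≤ zero    y = ℕ.m≤m+n (1 * y) 1
  2^k*T^k≤ (suc k) y = begin
    2 ^ suc k * (T ^ᶠ suc k) y
      ≡⟨ cong ((2 ^ suc k) *_) (T^-suc k y) ⟩
    2 * 2 ^ k * (T ^ᶠ k) (T y)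
      ≡⟨ ℕ.*-assoc 2 (2 ^ k) _ ⟩
    2 * (2 ^ k * (T ^ᶠ k) (T y))
      ≤⟨ ℕ.*-monoʳ-≤ 2 (2^k*T^k≤ k (T y)) ⟩
    2 * (3 ^ oddSteps k (T y) * T y + 3 ^ k)
      ≤⟨ step y (parity y) ⟩
    3 ^ oddSteps (suc k) y * y + 3 ^ suc k ∎
    where
    open ℕ.≤-Reasoning
    even-step : ∀ p r z → 2 * (p * z + r) + r ≡ p * (z * 2) + 3 * r
    even-step = solve-∀
    odd-step : ∀ p r z → 2 * (p * (2 + 3 * z) + r) ≡ 3 * p * (1 + z * 2) + (p + 2 * r)
    odd-step = solve-∀
    step : ∀ y → Parity y → 2 * (3 ^ oddSteps k (T y) * T y + 3 ^ k) ≤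
                            3 ^ oddSteps (suc k) y * y + 3 ^ suc k
    step _ (even z) rewrite oddSteps-even k z | T-even z = begin
      2 * (3 ^ oddSteps k z * z + 3 ^ k)          ≤⟨ ℕ.m≤m+n _ (3 ^ k) ⟩
      2 * (3 ^ oddSteps k z * z + 3 ^ k) + 3 ^ k  ≡⟨ even-step (3 ^ oddSteps k z) (3 ^ k) z ⟩
      3 ^ oddSteps k z * (z * 2) + 3 ^ suc k      ∎
    step _ (odd z) rewrite oddSteps-odd k z | T-odd z = begin
      2 * (3 ^ j * (2 + 3 * z) + 3 ^ k)
        ≡⟨ odd-step (3 ^ j) (3 ^ k) z ⟩
      3 ^ suc j * (1 + z * 2) + (3 ^ j + 2 * 3 ^ k)
        ≤⟨ ℕ.+-monoʳ-≤ (3 ^ suc j * (1 + z * 2))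
             (ℕ.+-monoˡ-≤ (2 * 3 ^ k) (ℕ.^-monoʳ-≤ 3 (oddSteps≤ k (2 + 3 * z)))) ⟩
      3 ^ suc j * (1 + z * 2) + 3 ^ suc k ∎
      where j = oddSteps k (2 + 3 * z)

  -- The exact sum of 2^j over 2^k terms of a progression.

  -- Arithmetic progressions of odd difference are needed: the odd members of
  -- one are mapped by T to another one, with its difference multiplied by 3.
  Σ<-2^oddSteps : ∀ k a b → Σ< (2 ^ k) (λ y → 2 ^ oddSteps k (b + (1 + a * 2) * y)) ≡ 3 ^ k
  Σ<-2^oddSteps zero    a b = refl
  Σ<-2^oddSteps (suc k) a b = begin
    Σ< (2 * 2 ^ k) f
      ≡⟨ cong (λ n → Σ< n f) (ℕ.*-comm 2 (2 ^ k)) ⟩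
    Σ< (2 ^ k * 2) f
      ≡⟨ Σ<-even-odd (2 ^ k) f ⟩
    Σ< (2 ^ k) (λ y → f (y * 2)) + Σ< (2 ^ k) (λ y → f (1 + y * 2))
      -- As the difference is odd, even and odd members alternate. The even half contributes 3^k,
      -- and the odd half 2 * 3^k because each member has one more odd step.
      ≡⟨ step (parity b) ⟩
    3 ^ suc k ∎
    where
    open ≡-Reasoning
    f : ℕ → ℕ
    f y = 2 ^ oddSteps (suc k) (b + (1 + a * 2) * y)

    evens : ∀ (g h : ℕ → ℕ) b → (∀ y → g y ≡ h y * 2) →
      (∀ y → h y ≡ b + (1 + a * 2) * y) →
      Σ< (2 ^ k) (λ y → 2 ^ oddSteps (suc k) (g y)) ≡ 3 ^ k
    evens g h b g≡ h≡ = trans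
      (Σ<-cong (2 ^ k) (λ y → cong (2 ^_) (trans (cong (oddSteps (suc k)) (g≡ y))
        (trans (oddSteps-even k (h y)) (cong (oddSteps k) (h≡ y))))))
      (Σ<-2^oddSteps k a b)

    odds : ∀ (g h : ℕ → ℕ) b → (∀ y → g y ≡ 1 + h y * 2) →
      (∀ y → 2 + 3 * h y ≡ b + (1 + (1 + 3 * a) * 2) * y) →
      Σ< (2 ^ k) (λ y → 2 ^ oddSteps (suc k) (g y)) ≡ 2 * 3 ^ k
    odds g h b g≡ h≡ = trans
      (Σ<-cong (2 ^ k) (λ y → cong (2 ^_) (trans (cong (oddSteps (suc k)) (g≡ y))
        (trans (oddSteps-odd k (h y)) (cong (λ x → suc (oddSteps k x)) (h≡ y))))))
      -- The new difference is 3 (1 + 2a) = 1 + 2 (1 + 3a), so the induction hypothesis is taken at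
      -- `1 + 3 * a`.
      (trans (Σ<-distribˡ-* 2 (2 ^ k) _) (cong (2 *_) (Σ<-2^oddSteps k (1 + 3 * a) b)))

    step : ∀ {b} → Parity b →
      Σ< (2 ^ k) (λ y → 2 ^ oddSteps (suc k) (b + (1 + a * 2) * (y * 2))) +
      Σ< (2 ^ k) (λ y → 2 ^ oddSteps (suc k) (b + (1 + a * 2) * (1 + y * 2))) ≡ 3 ^ suc k
    step (even z) = cong₂ _+_
      (evens _ (λ y → z + (1 + a * 2) * y) z (e₁ a z) (λ _ → refl))
      (odds _ (λ y → z + a + (1 + a * 2) * y) (2 + 3 * (z + a)) (e₂ a z) (e₃ a z))
      where
      e₁ : ∀ a z y → z * 2 + (1 + a * 2) * (y * 2) ≡ (z + (1 + a * 2) * y) * 2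
      e₁ = solve-∀
      e₂ : ∀ a z y → z * 2 + (1 + a * 2) * (1 + y * 2) ≡ 1 + (z + a + (1 + a * 2) * y) * 2
      e₂ = solve-∀
      e₃ : ∀ a z y → 2 + 3 * (z + a + (1 + a * 2) * y) ≡
                     2 + 3 * (z + a) + (1 + (1 + 3 * a) * 2) * y
      e₃ = solve-∀
    step (odd z) = trans (cong₂ _+_
      (odds _ (λ y → z + (1 + a * 2) * y) (2 + 3 * z) (e₁ a z) (e₂ a z))
      (evens _ (λ y → 1 + z + a + (1 + a * 2) * y) (1 + z + a) (e₃ a z) (λ _ → refl)))
      (ℕ.+-comm (2 * 3 ^ k) (3 ^ k))
      where
      e₁ : ∀ a z y → 1 + z * 2 + (1 + a * 2) * (y * 2) ≡ 1 + (z + (1 + a * 2) * y) * 2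
      e₁ = solve-∀
      e₂ : ∀ a z y → 2 + 3 * (z + (1 + a * 2) * y) ≡
                     2 + 3 * z + (1 + (1 + 3 * a) * 2) * y
      e₂ = solve-∀
      e₃ : ∀ a z y → 1 + z * 2 + (1 + a * 2) * (1 + y * 2) ≡
                     (1 + z + a + (1 + a * 2) * y) * 2
      e₃ = solve-∀

  Σ<-blocks-2^oddSteps : ∀ k q → Σ< (q * 2 ^ k) (λ y → 2 ^ oddSteps k y) ≡ q * 3 ^ k
  Σ<-blocks-2^oddSteps k q = Σ<-blocks q (2 ^ k) (λ y → 2 ^ oddSteps k y) λ b →
    trans (Σ<-cong (2 ^ k) (λ y → cong (λ x → 2 ^ oddSteps k (b + x)) (sym (ℕ.*-identityˡ y))))
          -- With `a = 0` the difference is 1 and the progression is a window of consecutive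
          -- numbers.
          (Σ<-2^oddSteps k 0 b)

  -- Growth of powers with an explicit threshold.

  bernoulli : ∀ a b m → a < b → (a + m) * a ^ m ≤ a * b ^ m
  bernoulli a b zero    a<b rewrite ℕ.+-identityʳ a = ℕ.≤-refl
  bernoulli a b (suc m) a<b = begin
    (a + suc m) * a ^ suc m            ≤⟨ ℕ.m≤m+n _ (m * a ^ m) ⟩
    (a + suc m) * (a * a ^ m) + m * a ^ m ≡⟨ expand a m (a ^ m) ⟩
    (1 + a) * ((a + m) * a ^ m)        ≤⟨ ℕ.*-mono-≤ a<b (bernoulli a b m a<b) ⟩
    b * (a * b ^ m)                    ≡⟨ swap a b (b ^ m) ⟩
    a * b ^ suc m ∎
    where
    open ℕ.≤-Reasoning
    expand : ∀ a m p → (a + suc m) * (a * p) + m * p ≡ (1 + a) * ((a + m) * p)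
    expand = solve-∀
    swap : ∀ a b p → b * (a * p) ≡ a * (b * p)
    swap = solve-∀

  -- Since b ≥ a + 1, Bernoulli's inequality gives (b/a)^m ≥ 1 + m/a, which is at least C once m ≥ C
  -- a.
  exponential-growth : ∀ C a b m .{{_ : NonZero a}} → a < b → C * a ≤ m →
    C * a ^ m ≤ b ^ m
  exponential-growth C a b m a<b Ca≤m = ℕ.*-cancelˡ-≤ a (begin
    a * (C * a ^ m)  ≡⟨ swap a C (a ^ m) ⟩
    C * a * a ^ m    ≤⟨ ℕ.*-monoˡ-≤ (a ^ m) (ℕ.≤-trans Ca≤m (ℕ.m≤n+m m a)) ⟩
    (a + m) * a ^ m  ≤⟨ bernoulli a b m a<b ⟩
    a * b ^ m        ∎)
    where
    open ℕ.≤-Reasoning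
    swap : ∀ a c p → a * (c * p) ≡ c * a * p
    swap = solve-∀

  -- Descent by a factor `D` outside a set of small proportion.

  Descends : ℕ → Pred ℕ 0ℓ
  Descends D y = ∃[ k ] (D * (T ^ᶠ k) y < y)

  -- For positive `E` this is the eventual bound |F|/n ≥ 1 - 1/E, cleared of denominators.
  AlmostAll : Pred ℕ 0ℓ → ℕ → Set
  AlmostAll A E = ∃[ N ] (∀ n → N ≤ n → ∃[ F ] (_⊆_ {suc n} F A × E * n ≤ E * ∣ F ∣ + n))

  -- Here `t` is the cutoff for the number of odd steps. By `contraction`, large y with at most `t`
  -- odd steps descend. By `tail`, the Markov bound (3/2)^k / 2^t for the others is at most 1/(2E),
  -- which leaves another 1/(2E) for boundary terms.
  module _ (D E k t : ℕ) (contraction : D * (3 ^ t + 1) < 2 ^ k)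
           (tail : 2 * E * 3 ^ k ≤ 2 ^ t * 2 ^ k) where
    private
      Y = 3 ^ k

      few-odd⇒descends : ∀ y → Y ≤ y → oddSteps k y ≤ t → D * (T ^ᶠ k) y < y
      few-odd⇒descends y Y≤y j≤t = ℕ.*-cancelˡ-< (2 ^ k) (D * (T ^ᶠ k) y) y (begin-strict
        2 ^ k * (D * (T ^ᶠ k) y)      ≡⟨ swap (2 ^ k) D ((T ^ᶠ k) y) ⟩
        D * (2 ^ k * (T ^ᶠ k) y)      ≤⟨ ℕ.*-monoʳ-≤ D (2^k*T^k≤ k y) ⟩
        D * (3 ^ oddSteps k y * y + Y)
          -- The additive error 3^k is at most y and becomes the `+ 1` in `contraction`.
          ≤⟨ ℕ.*-monoʳ-≤ D (ℕ.+-mono-≤ (ℕ.*-monoˡ-≤ y (ℕ.^-monoʳ-≤ 3 j≤t)) Y≤y) ⟩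
        D * (3 ^ t * y + y)           ≡⟨ factor D (3 ^ t) y ⟩
        D * (3 ^ t + 1) * y           <⟨ ℕ.*-monoˡ-< y contraction ⟩
        2 ^ k * y                     ∎)
        where
        open ℕ.≤-Reasoning
        instance y≢0 = ℕ.>-nonZero (ℕ.<-≤-trans (ℕ.m^n>0 3 k) Y≤y)
        swap : ∀ a b c → a * (b * c) ≡ b * (a * c)
        swap = solve-∀
        factor : ∀ d p y → d * (p * y + y) ≡ d * (p + 1) * y
        factor = solve-∀

      -- The second summand disposes of the finitely many y < Y.
      weight : ℕ → ℕ
      weight y = 2 ^ oddSteps k y + 2 ^ t * (Y ∸ y)

      dichotomy : ∀ y → Descends D y ⊎ 2 ^ t ≤ weight y
      dichotomy y with ℕ.≤-<-connex Y y | ℕ.≤-<-connex (oddSteps k y) t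
      ... | inj₂ y<Y | _        = inj₂ (ℕ.≤-trans
        (ℕ.m≤m*n (2 ^ t) (Y ∸ y) {{ℕ.>-nonZero (ℕ.m<n⇒0<n∸m y<Y)}})
        (ℕ.m≤n+m _ (2 ^ oddSteps k y)))
      ... | inj₁ Y≤y | inj₁ j≤t = inj₁ (k , few-odd⇒descends y Y≤y j≤t)
      ... | inj₁ Y≤y | inj₂ t<j = inj₂ (ℕ.≤-trans
        (ℕ.^-monoʳ-≤ 2 (ℕ.<⇒≤ t<j)) (ℕ.m≤m+n (2 ^ oddSteps k y) _))

      Σ<-weight : ∀ n → 2 * E * Σ< (suc n) weight ≤ 2 ^ t * (n + 2 ^ k + 2 * E * (Y * Y))
      Σ<-weight n = begin
        2 * E * Σ< (suc n) weight
          ≡⟨ cong ((2 * E) *_) (Σ<-distrib-+ (suc n) (λ y → 2 ^ oddSteps k y) (λ y → 2 ^ t * (Y ∸ y))) ⟩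
        2 * E * (Σ< (suc n) (λ y → 2 ^ oddSteps k y) + Σ< (suc n) (λ y → 2 ^ t * (Y ∸ y)))
          ≤⟨ ℕ.*-monoʳ-≤ (2 * E) (ℕ.+-mono-≤
               (ℕ.≤-trans (Σ<-monoˡ-≤ _ n<q*2^k) (ℕ.≤-reflexive (Σ<-blocks-2^oddSteps k q)))
               (ℕ.≤-trans (ℕ.≤-reflexive (Σ<-distribˡ-* (2 ^ t) (suc n) (Y ∸_)))
                          (ℕ.*-monoʳ-≤ (2 ^ t) (Σ<-∸ (suc n) Y)))) ⟩
        2 * E * (q * Y + 2 ^ t * (Y * Y))
          ≡⟨ regroup E q Y (2 ^ t) (Y * Y) ⟩
        q * (2 * E * Y) + 2 ^ t * (2 * E * (Y * Y))
          ≤⟨ ℕ.+-monoˡ-≤ _ (ℕ.*-monoʳ-≤ q tail) ⟩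
        q * (2 ^ t * 2 ^ k) + 2 ^ t * (2 * E * (Y * Y))
          ≡⟨ collect q (2 ^ t) (2 ^ k) (2 * E * (Y * Y)) ⟩
        2 ^ t * (q * 2 ^ k + 2 * E * (Y * Y))
          ≤⟨ ℕ.*-monoʳ-≤ (2 ^ t) (ℕ.+-monoˡ-≤ (2 * E * (Y * Y)) q*2^k≤) ⟩
        2 ^ t * (n + 2 ^ k + 2 * E * (Y * Y)) ∎
        where
        open ℕ.≤-Reasoning
        instance 2^k≢0 = ℕ.m^n≢0 2 k
        -- Rounded up to whole blocks: `q` blocks cover 0, ..., n and overshoot n by at most 2^k.
        q = suc (n / 2 ^ k)
        n<q*2^k : n < q * 2 ^ k
        n<q*2^k = subst (_< q * 2 ^ k) (sym (m≡m%n+[m/n]*n n (2 ^ k)))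
          (ℕ.+-monoˡ-< (n / 2 ^ k * 2 ^ k) (m%n<n n (2 ^ k)))
        q*2^k≤ : q * 2 ^ k ≤ n + 2 ^ k
        q*2^k≤ = ℕ.≤-trans (ℕ.+-monoʳ-≤ (2 ^ k) (m/n*n≤m n (2 ^ k)))
          (ℕ.≤-reflexive (ℕ.+-comm (2 ^ k) n))
        regroup : ∀ e q y w r → 2 * e * (q * y + w * r) ≡ q * (2 * e * y) + w * (2 * e * r)
        regroup = solve-∀
        collect : ∀ q w n r → q * (w * n) + w * r ≡ w * (q * n + r)
        collect = solve-∀

    contraction∧tail⇒almostAll : AlmostAll (Descends D) E
    -- The threshold is the part of the bound `Σ<-weight` that stays fixed as n grows. Beyond it the
    -- whole bound is at most 2^t * 2n.
    contraction∧tail⇒almostAll = 2 ^ k + 2 * E * (Y * Y) , λ n N≤n →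
      let F , F⊆ , bound = markov (2 ^ t) (suc n) weight dichotomy
      in F , F⊆ , ℕ.*-cancelˡ-≤ 2 (ℕ.*-cancelˡ-≤ (2 ^ t) (begin
        2 ^ t * (2 * (E * n))
          ≡⟨ regroup (2 ^ t) E n ⟩
        2 * E * (2 ^ t * n)
          -- Markov's inequality counts the n + 1 numbers 0, ..., n, whereas the ratio is taken over
          -- n.
          ≤⟨ ℕ.*-monoʳ-≤ (2 * E) (ℕ.≤-trans (ℕ.*-monoʳ-≤ (2 ^ t) (ℕ.n≤1+n n)) bound) ⟩
        2 * E * (2 ^ t * ∣ F ∣ + Σ< (suc n) weight)
          ≡⟨ ℕ.*-distribˡ-+ (2 * E) (2 ^ t * ∣ F ∣) (Σ< (suc n) weight) ⟩
        2 * E * (2 ^ t * ∣ F ∣) + 2 * E * Σ< (suc n) weight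
          ≤⟨ ℕ.+-monoʳ-≤ (2 * E * (2 ^ t * ∣ F ∣)) (Σ<-weight n) ⟩
        2 * E * (2 ^ t * ∣ F ∣) + 2 ^ t * (n + 2 ^ k + 2 * E * (Y * Y))
          ≡⟨ collect E (2 ^ t) (∣ F ∣) n (2 ^ k) (2 * E * (Y * Y)) ⟩
        2 ^ t * (2 * (E * ∣ F ∣) + n + (2 ^ k + 2 * E * (Y * Y)))
          ≤⟨ ℕ.*-monoʳ-≤ (2 ^ t) (ℕ.+-monoʳ-≤ (2 * (E * ∣ F ∣) + n) N≤n) ⟩
        2 ^ t * (2 * (E * ∣ F ∣) + n + n)
          ≡⟨ halve (2 ^ t) (E * ∣ F ∣) n ⟩
        2 ^ t * (2 * (E * ∣ F ∣ + n)) ∎))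
      where
      open ℕ.≤-Reasoning
      instance 2^t≢0 = ℕ.m^n≢0 2 t
      regroup : ∀ w e n → w * (2 * (e * n)) ≡ 2 * e * (w * n)
      regroup = solve-∀
      collect : ∀ e w f n p r →
        2 * e * (w * f) + w * (n + p + r) ≡ w * (2 * (e * f) + n + (p + r))
      collect = solve-∀
      halve : ∀ w x n → w * (2 * x + n + n) ≡ w * (2 * (x + n))
      halve = solve-∀

  -- With k = 8m and t = 5m both conditions compare m-th powers: 3^5 = 243 < 256 = 2^8 and 3^8 =
  -- 6561 < 8192 = 2^13. The slope 5/8 lies between log(3/2)/log 2 ≈ 0.585, required for the tail,
  -- and log 2/log 3 ≈ 0.631, required for the contraction.
  module _ (D E m : ℕ) (D≤m : (1 + 2 * D) * 243 ≤ m) (E≤m : 2 * E * 6561 ≤ m) where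
    open ℕ.≤-Reasoning
    private
      contraction : D * (3 ^ (5 * m) + 1) < 2 ^ (8 * m)
      contraction = begin-strict
        D * (3 ^ (5 * m) + 1)
          ≤⟨ ℕ.*-monoʳ-≤ D (ℕ.+-monoʳ-≤ (3 ^ (5 * m)) (ℕ.m^n>0 3 (5 * m))) ⟩
        D * (3 ^ (5 * m) + 3 ^ (5 * m))
          -- One further positive summand makes the inequality strict, whence the factor 1 + 2D.
          <⟨ ℕ.+-monoˡ-≤ (D * (3 ^ (5 * m) + 3 ^ (5 * m))) (ℕ.m^n>0 3 (5 * m)) ⟩
        3 ^ (5 * m) + D * (3 ^ (5 * m) + 3 ^ (5 * m))
          ≡⟨ collect D (3 ^ (5 * m)) ⟩
        (1 + 2 * D) * 3 ^ (5 * m)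
          ≡⟨ cong ((1 + 2 * D) *_) (ℕ.^-*-assoc 3 5 m) ⟨
        (1 + 2 * D) * 243 ^ m
          ≤⟨ exponential-growth (1 + 2 * D) 243 256 m (ℕ.<ᵇ⇒< 243 256 _) D≤m ⟩
        256 ^ m
          ≡⟨ ℕ.^-*-assoc 2 8 m ⟩
        2 ^ (8 * m) ∎
        where
        collect : ∀ d p → p + d * (p + p) ≡ (1 + 2 * d) * p
        collect = solve-∀

      tail : 2 * E * 3 ^ (8 * m) ≤ 2 ^ (5 * m) * 2 ^ (8 * m)
      tail = begin
        2 * E * 3 ^ (8 * m)       ≡⟨ cong ((2 * E) *_) (ℕ.^-*-assoc 3 8 m) ⟨
        2 * E * 6561 ^ m          ≤⟨ exponential-growth (2 * E) 6561 8192 m (ℕ.<ᵇ⇒< 6561 8192 _) E≤m ⟩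
        8192 ^ m                  ≡⟨ ℕ.^-*-assoc 2 13 m ⟩
        2 ^ (13 * m)              ≡⟨ cong (2 ^_) (ℕ.*-distribʳ-+ m 5 8) ⟩
        2 ^ (5 * m + 8 * m)       ≡⟨ ℕ.^-distribˡ-+-* 2 (5 * m) (8 * m) ⟩
        2 ^ (5 * m) * 2 ^ (8 * m) ∎

    large-exponent⇒almostAll : AlmostAll (Descends D) E
    large-exponent⇒almostAll =
      contraction∧tail⇒almostAll D E (8 * m) (5 * m) contraction tail

  almostAll-descend : ∀ D E → AlmostAll (Descends D) E
  -- Unification with the two bounds sets m to the sum of both thresholds.
  almostAll-descend D E = large-exponent⇒almostAll D E _
    (ℕ.m≤m+n ((1 + 2 * D) * 243) (2 * E * 6561))
    (ℕ.m≤n+m (2 * E * 6561) ((1 + 2 * D) * 243))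

open Collatz using (Descends; AlmostAll; almostAll-descend)
import Data.Integer.Properties as ℤ
open import Data.Integer.Base as ℤ using (+_; +[1+_]; -[1+_])
open import Defs
open import Algebra.Properties.Group ℚ.+-0-group using (//-rightDividesʳ)
open import Algebra.Properties.CommutativeSemigroup
  (CommutativeMonoid.commutativeSemigroup ℚ.+-0-commutativeMonoid) using (xy∙z≈xz∙y)

-- Comparison of fractions, and fractions below positive reals.

fraction-sum-≤ : ∀ a b e g c d f h
  .{{_ : NonZero c}} .{{_ : NonZero d}} .{{_ : NonZero f}} .{{_ : NonZero h}} →
  (a ℕ.* d ℕ.+ b ℕ.* c) ℕ.* (f ℕ.* h) ℕ.≤ (e ℕ.* h ℕ.+ g ℕ.* f) ℕ.* (c ℕ.* d) →
  (+ a ℚ./ c) ℚ.+ (+ b ℚ./ d) ℚ.≤ (+ e ℚ./ f) ℚ.+ (+ g ℚ./ h)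
-- Passing to unnormalised rationals keeps the given numerators and denominators, so
-- cross-multiplication yields the natural-number hypothesis.
fraction-sum-≤ a b e g (suc c) (suc d) (suc f) (suc h) le = ℚ.toℚᵘ-cancel-≤ (begin
  ℚ.toℚᵘ ((+ a ℚ./ suc c) ℚ.+ (+ b ℚ./ suc d))  ≃⟨ toℚᵘ-sum a b c d ⟩
  mkℚᵘ (+ a) c ℚᵘ.+ mkℚᵘ (+ b) d                ≤⟨ *≤* numerators ⟩
  mkℚᵘ (+ e) f ℚᵘ.+ mkℚᵘ (+ g) h                ≃⟨ toℚᵘ-sum e g f h ⟨
  ℚ.toℚᵘ ((+ e ℚ./ suc f) ℚ.+ (+ g ℚ./ suc h))  ∎)
  where
  open ℚᵘ.≤-Reasoning
  toℚᵘ-sum : ∀ a b c d → ℚ.toℚᵘ ((+ a ℚ./ suc c) ℚ.+ (+ b ℚ./ suc d)) ℚᵘ.≃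
                         mkℚᵘ (+ a) c ℚᵘ.+ mkℚᵘ (+ b) d
  toℚᵘ-sum a b c d = ℚᵘ.≃-trans
    (ℚ.toℚᵘ-homo-+ (+ a ℚ./ suc c) (+ b ℚ./ suc d))
    (ℚᵘ.+-cong (ℚ.toℚᵘ-fromℚᵘ (mkℚᵘ (+ a) c)) (ℚ.toℚᵘ-fromℚᵘ (mkℚᵘ (+ b) d)))

  pos-cross : ∀ a b c d f h →
    ((+ a ℤ.* + suc d) ℤ.+ (+ b ℤ.* + suc c)) ℤ.* (+ (suc f ℕ.* suc h)) ≡
    + ((a ℕ.* suc d ℕ.+ b ℕ.* suc c) ℕ.* (suc f ℕ.* suc h))
  pos-cross a b c d f h = trans
    (cong (ℤ._* (+ (suc f ℕ.* suc h)))
      (cong₂ ℤ._+_ (sym (ℤ.pos-* a (suc d))) (sym (ℤ.pos-* b (suc c)))))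
    (sym (ℤ.pos-* (a ℕ.* suc d ℕ.+ b ℕ.* suc c) (suc f ℕ.* suc h)))

  numerators = subst₂ ℤ._≤_ (sym (pos-cross a b c d f h)) (sym (pos-cross e g f h c d))
    (ℤ.+≤+ le)

/-≤-1/*/ : ∀ y d .{{_ : NonZero d}} →
  (+ y ℚ./ d) ℚ.≤ (+ 1 ℚ./ d) ℚ.* (+ y ℚ./ 1)
/-≤-1/*/ y (suc d) = ℚ.toℚᵘ-cancel-≤ (begin
  ℚ.toℚᵘ (+ y ℚ./ suc d)                     ≃⟨ ℚ.toℚᵘ-fromℚᵘ (mkℚᵘ (+ y) d) ⟩
  mkℚᵘ (+ y) d                               ≃⟨ ℚᵘ.*≡* (cong₂ ℤ._*_
    (sym (ℤ.*-identityˡ (+ y))) (cong +_ (ℕ.*-identityʳ (suc d)))) ⟩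
  mkℚᵘ (+ 1) d ℚᵘ.* mkℚᵘ (+ y) 0
    ≃⟨ ℚᵘ.*-cong (ℚ.toℚᵘ-fromℚᵘ (mkℚᵘ (+ 1) d)) (ℚ.toℚᵘ-fromℚᵘ (mkℚᵘ (+ y) 0)) ⟨
  ℚ.toℚᵘ (+ 1 ℚ./ suc d) ℚᵘ.* ℚ.toℚᵘ (+ y ℚ./ 1)
    ≃⟨ ℚ.toℚᵘ-homo-* (+ 1 ℚ./ suc d) (+ y ℚ./ 1) ⟨
  ℚ.toℚᵘ ((+ 1 ℚ./ suc d) ℚ.* (+ y ℚ./ 1))   ∎)
  where open ℚᵘ.≤-Reasoning

archimedean : ∀ g {δ} → 0ℚ ℚ.< δ → ∃[ e ] ((+ g ℚ./ suc e) ℚ.≤ δ)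
-- For δ = (p+1)/(d+1) the denominator g (d+1) + 1 works, as g / (g (d+1) + 1) ≤ 1/(d+1) ≤ δ.
archimedean g {δ@(mkℚ +[1+ p ] d _)} _ = g ℕ.* suc d , ℚ.toℚᵘ-cancel-≤ (begin
  ℚ.toℚᵘ (+ g ℚ./ suc (g ℕ.* suc d))  ≃⟨ ℚ.toℚᵘ-fromℚᵘ (mkℚᵘ (+ g) (g ℕ.* suc d)) ⟩
  mkℚᵘ (+ g) (g ℕ.* suc d)            ≤⟨ *≤* cross ⟩
  ℚ.toℚᵘ δ                            ∎)
  where
  open ℚᵘ.≤-Reasoning
  cross : + g ℤ.* + suc d ℤ.≤ + suc p ℤ.* + suc (g ℕ.* suc d)
  cross = subst₂ ℤ._≤_ (ℤ.pos-* g (suc d)) (ℤ.pos-* (suc p) (suc (g ℕ.* suc d)))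
    (ℤ.+≤+ (ℕ.≤-trans (ℕ.n≤1+n (g ℕ.* suc d)) (ℕ.m≤n*m (suc (g ℕ.* suc d)) (suc p))))
archimedean g {mkℚ (+ 0) d _} (ℚ.*<* (ℤ.+<+ ()))
archimedean g {mkℚ -[1+ p ] d _} (ℚ.*<* ())

-- Positivity of c and of ε enters the estimates in this form. The numerator 2 is used for ε, so
-- that it splits into two equal parts.
positive-real⇒≥fraction : ∀ g x → 0ℝ < x →
  ∃[ e ] ∃[ N ] (∀ n → N ℕ.≤ n → (+ g ℚ./ suc e) ℚ.≤ seq x n)
positive-real⇒≥fraction g x (δ , 0<δ , N , gap) =
  let e , g/e≤δ = archimedean g 0<δ
  in e , N , λ n N≤n → ℚ.≤-trans g/e≤δ
       (subst (ℚ._≤ seq x n) (ℚ.+-identityˡ δ) (gap n N≤n))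

1/suc-pos : ∀ e → 0ℚ ℚ.< + 1 ℚ./ suc e
1/suc-pos e = ℚ.positive⁻¹ (+ 1 ℚ./ suc e) {{ℚ.normalize-pos 1 (suc e)}}

-- Membership in `M c` and density 1.

descends⇒M : ∀ c d {N} → (∀ n → N ℕ.≤ n → (+ 1 ℚ./ suc d) ℚ.≤ seq c n) →
  ∀ y → Descends (suc d) y → M c y
descends⇒M c d {N} 1/d≤c y (k , dT<y) =
  -- With D = d + 1 and t = T^k(y), integrality turns D t < y into D t + 1 ≤ y, that is t + 1/D ≤
  -- y/D ≤ c y; so 1/D serves as the gap.
  k , + 1 ℚ./ suc d , 1/suc-pos d , N , λ n N≤n → begin
    (+ t ℚ./ 1) ℚ.+ (+ 1 ℚ./ suc d)
      ≤⟨ fraction-sum-≤ t 1 y 0 1 (suc d) (suc d) 1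
           (ℕ.*-mono-≤ numerators (ℕ.≤-reflexive (ℕ.*-comm (suc d) 1))) ⟩
    (+ y ℚ./ suc d) ℚ.+ 0ℚ
      ≡⟨ ℚ.+-identityʳ (+ y ℚ./ suc d) ⟩
    + y ℚ./ suc d
      ≤⟨ /-≤-1/*/ y (suc d) ⟩
    (+ 1 ℚ./ suc d) ℚ.* (+ y ℚ./ 1)
      ≤⟨ ℚ.*-monoʳ-≤-nonNeg (+ y ℚ./ 1) {{ℚ.normalize-nonNeg y 1}} (1/d≤c n N≤n) ⟩
    seq c n ℚ.* (+ y ℚ./ 1) ∎
  where
  open ℚ.≤-Reasoning
  t = (T ^ᶠ k) y
  rearrange : ∀ t d → suc (d ℕ.* t) ≡ t ℕ.* d ℕ.+ 1 ℕ.* 1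
  rearrange = solve-∀
  numerators : t ℕ.* suc d ℕ.+ 1 ℕ.* 1 ℕ.≤ y ℕ.* 1 ℕ.+ 0 ℕ.* suc d
  numerators = subst₂ ℕ._≤_ (rearrange t (suc d))
    (sym (trans (ℕ.+-identityʳ (y ℕ.* 1)) (ℕ.*-identityʳ y))) dT<y

eventually⇒frequently : ∀ (P : PositiveIndexed) → Eventually P → Frequently P
eventually⇒frequently P (N , eventually) m =
  suc (N ℕ.+ m) , _ , ℕ.≤-trans (ℕ.m≤n+m m N) (ℕ.n≤1+n (N ℕ.+ m)) ,
  eventually (suc (N ℕ.+ m)) (ℕ.≤-trans (ℕ.m≤m+n N m) (ℕ.n≤1+n (N ℕ.+ m)))

-- The interval [0,n] has n + 1 elements, so the ratio can reach 1 + 1/n. Of ε ≥ 2/e, one 1/e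
-- absorbs this excess once n ≥ e, and the other is the gap of the strict order.
eventually-ratio<1+ε : ∀ A ε → 0ℝ < ε → Eventually (Ratio< A (1ℝ + ε))
eventually-ratio<1+ε A ε 0<ε =
  let e , N , 2/e≤ε = positive-real⇒≥fraction 2 ε 0<ε
  in suc e , λ n e≤n F F⊆A → + 1 ℚ./ suc e , 1/suc-pos e , N , λ i N≤i →
    ℚ.≤-trans
      (fraction-sum-≤ (Subset.∣ F ∣) 1 1 2 n (suc e) 1 (suc e)
        (numerators n (suc e) (∣p∣≤n F) e≤n))
      (ℚ.+-monoʳ-≤ (+ 1 ℚ./ 1) (2/e≤ε i N≤i))
  where
  open ℕ.≤-Reasoning
  regroup₁ : ∀ n e → (suc n ℕ.* e ℕ.+ 1 ℕ.* n) ℕ.* (1 ℕ.* e) ≡ (n ℕ.* e ℕ.+ n ℕ.+ e) ℕ.* e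
  regroup₁ = solve-∀
  regroup₂ : ∀ n e → (n ℕ.* e ℕ.+ n ℕ.+ n) ℕ.* e ≡ (1 ℕ.* e ℕ.+ 2 ℕ.* 1) ℕ.* (n ℕ.* e)
  regroup₂ = solve-∀
  numerators : ∀ n e {f} → f ℕ.≤ suc n → e ℕ.≤ n →
    (f ℕ.* e ℕ.+ 1 ℕ.* n) ℕ.* (1 ℕ.* e) ℕ.≤ (1 ℕ.* e ℕ.+ 2 ℕ.* 1) ℕ.* (n ℕ.* e)
  numerators n e {f} f≤1+n e≤n = begin
    (f ℕ.* e ℕ.+ 1 ℕ.* n) ℕ.* (1 ℕ.* e)
      ≤⟨ ℕ.*-monoˡ-≤ (1 ℕ.* e) (ℕ.+-monoˡ-≤ (1 ℕ.* n) (ℕ.*-monoˡ-≤ e f≤1+n)) ⟩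
    (suc n ℕ.* e ℕ.+ 1 ℕ.* n) ℕ.* (1 ℕ.* e)
      ≡⟨ regroup₁ n e ⟩
    (n ℕ.* e ℕ.+ n ℕ.+ e) ℕ.* e
      ≤⟨ ℕ.*-monoˡ-≤ e (ℕ.+-monoʳ-≤ (n ℕ.* e ℕ.+ n) e≤n) ⟩
    (n ℕ.* e ℕ.+ n ℕ.+ n) ℕ.* e
      ≡⟨ regroup₂ n e ⟩
    (1 ℕ.* e ℕ.+ 2 ℕ.* 1) ℕ.* (n ℕ.* e) ∎

-- Of ε ≥ 2/e, one 1/e is the proportion that `AlmostAll A e` may lose, and the other is the gap of
-- the strict order.
eventually-1-ε<ratio : ∀ A → (∀ E → AlmostAll A E) →
  ∀ ε → 0ℝ < ε → Eventually (<Ratio A (1ℝ - ε))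
eventually-1-ε<ratio A almostAll ε 0<ε =
  let e , N , 2/e≤ε = positive-real⇒≥fraction 2 ε 0<ε
      K , large     = almostAll (suc e)
  in K , λ n K≤n →
    let F , F⊆A , bound = large n K≤n
    in F , F⊆A , + 1 ℚ./ suc e , 1/suc-pos e , N , λ i N≤i →
      -- The subtraction of ε is moved to the right so that both sides are sums of fractions.
      move 1ℚ (+ 1 ℚ./ suc e) (+ Subset.∣ F ∣ ℚ./ n) (seq ε i) (ℚ.≤-trans
        (fraction-sum-≤ 1 1 (Subset.∣ F ∣) 2 1 (suc e) n (suc e)
          (numerators n (suc e) bound))
        (ℚ.+-monoʳ-≤ (+ Subset.∣ F ∣ ℚ./ n) (2/e≤ε i N≤i)))
  where
  open ℕ.≤-Reasoning
  regroup₁ : ∀ n e → (1 ℕ.* e ℕ.+ 1 ℕ.* 1) ℕ.* (n ℕ.* e) ≡ (e ℕ.* n ℕ.+ n) ℕ.* e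
  regroup₁ = solve-∀
  regroup₂ : ∀ f n e → (e ℕ.* f ℕ.+ n ℕ.+ n) ℕ.* e ≡ (f ℕ.* e ℕ.+ 2 ℕ.* n) ℕ.* (1 ℕ.* e)
  regroup₂ = solve-∀
  numerators : ∀ n e {f} → e ℕ.* n ℕ.≤ e ℕ.* f ℕ.+ n →
    (1 ℕ.* e ℕ.+ 1 ℕ.* 1) ℕ.* (n ℕ.* e) ℕ.≤ (f ℕ.* e ℕ.+ 2 ℕ.* n) ℕ.* (1 ℕ.* e)
  numerators n e {f} bound = begin
    (1 ℕ.* e ℕ.+ 1 ℕ.* 1) ℕ.* (n ℕ.* e)   ≡⟨ regroup₁ n e ⟩
    (e ℕ.* n ℕ.+ n) ℕ.* e                 ≤⟨ ℕ.*-monoˡ-≤ e (ℕ.+-monoˡ-≤ n bound) ⟩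
    (e ℕ.* f ℕ.+ n ℕ.+ n) ℕ.* e           ≡⟨ regroup₂ f n e ⟩
    (f ℕ.* e ℕ.+ 2 ℕ.* n) ℕ.* (1 ℕ.* e)   ∎
  move : ∀ a b c d → a ℚ.+ b ℚ.≤ c ℚ.+ d → a ℚ.- d ℚ.+ b ℚ.≤ c
  move a b c d le = subst₂ ℚ._≤_
    (xy∙z≈xz∙y a b (ℚ.- d)) (//-rightDividesʳ d c) (ℚ.+-monoˡ-≤ (ℚ.- d) le)

-- The same two eventual bounds serve limsup and liminf, since an eventual bound also holds
-- infinitely often.
almostAll⇒density-1 : ∀ A → (∀ E → AlmostAll A E) → HasDensity A 1ℝ
almostAll⇒density-1 A almostAll =
  (λ ε 0<ε → upper ε 0<ε , eventually⇒frequently (<Ratio A (1ℝ - ε)) (lower ε 0<ε)) ,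
  (λ ε 0<ε → lower ε 0<ε , eventually⇒frequently (Ratio< A (1ℝ + ε)) (upper ε 0<ε))
  where
  upper = eventually-ratio<1+ε A
  lower = eventually-1-ε<ratio A almostAll

corollary3p3 : ∀ (c : ℝ) → 0ℝ < c → HasDensity (M c) 1ℝ
corollary3p3 c 0<c = almostAll⇒density-1 (M c) λ E →
  -- As c is eventually at least 1/(d+1), descent by the factor d + 1 gives membership in `M c`.
  let d , _ , 1/d≤c = positive-real⇒≥fraction 1 c 0<c
      K , large     = almostAll-descend (suc d) E
  in K , λ n K≤n →
    let F , F⊆ , bound = large n K≤n
    in F , (λ i i∈F → descends⇒M c d 1/d≤c (toℕ i) (F⊆ i i∈F)) , bound
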